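{- We have $V_2(2,n)=(1+o(1))\,n^2\log_2 n$ as $n\to\infty$. Moreover, for every fixed $q\ge 2$ there are constants $c_q,c_q'>0$ such that for all integers $n\ge 2$, $$c_q n^q\log n\le V_2(q,n)\le c_q' n^q\log n.$$
   Context: The vertex online Ramsey number $V_2(q,n)$ is defined by the following game between builder and painter. At the start of stage $t\ge 1$ a new vertex $v_t$ is added; for each earlier vertex $v_i$, $i<t$, builder decides (in any order) whether to draw the edge $v_iv_t$, and painter must immediately color each drawn edge with one of $q$ colors. A monochromatic monotone path of length $n$ is a sequence $v_{a_1},\dots,v_{a_n}$ with $a_1<\dots<a_n$ such that all edges $v_{a_i}v_{a_{i+1}}$ are drawn and have the same color. $V_2(q,n)$ is the minimum number of edges builder must draw to guarantee a monochromatic monotone path of length $n$ regardless of painter's strategy. Logarithms are base 2 unless indicated. -}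

module Defs where

open import Data.Nat using (ℕ; zero; suc; _<_)
open import Data.Fin using (Fin)
open import Data.Product using (_×_; _,_; ∃)
open import Data.List using (List; []; _∷_)
open import Data.List.Membership.Propositional using (_∈_; _∉_)

-- Vertices are v_0, v_1, ... (0-indexed); a drawn, coloured edge v_i v_j
-- (i < j) with colour c is recorded as the triple (i , j , c).
Edges : ℕ → Set
Edges q = List (ℕ × ℕ × Fin q)

data MonoPath {q : ℕ} (E : Edges q) (c : Fin q) : ℕ → ℕ → Set where
  single : ∀ v → MonoPath E c 1 v
  extend : ∀ {l i j} → MonoPath E c l i → (i , j , c) ∈ E → MonoPath E c (suc l) j

-- monochromatic monotone path on n vertices (length n in the paper's sense)
HasMonoPath : (q n : ℕ) → Edges q → Set
HasMonoPath q n E = ∃ λ c → ∃ λ v → MonoPath E c n v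

-- Forces q n k cur E : in the position where the current (newest) vertex is
-- v_cur and the drawn coloured edges are E, builder has a strategy that
-- forces a monochromatic monotone path on n vertices while drawing at most
-- k further edges, against every painter.
-- Moves of builder: draw a not-yet-drawn edge v_i v_cur (i < cur), which
-- painter colours arbitrarily; or finish the stage (a new vertex is added).
data Forces (q n : ℕ) : ℕ → ℕ → Edges q → Set where
  win  : ∀ {k cur E} → HasMonoPath q n E → Forces q n k cur E
  draw : ∀ {k cur E} (i : ℕ) → i < cur → (∀ c → (i , cur , c) ∉ E) →
         (∀ c → Forces q n k cur ((i , cur , c) ∷ E)) →
         Forces q n (suc k) cur E
  next : ∀ {k cur E} → Forces q n k (suc cur) E → Forces q n k cur E

-- Builder can guarantee the path drawing at most k edges, i.e. V₂(q,n) ≤ k.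
BuilderWinsWithin : (q n k : ℕ) → Set
BuilderWinsWithin q n k = Forces q n k 0 []

{-# OPTIONS --safe #-}

-- Attach to every vertex v a label in ℕ^q whose coordinate c stands for the length of a
-- longest path of colour c ending at v.
--
-- Builder makes sure that no new label lies below an earlier one. Fixing all
-- coordinates but one splits the labels into at most n^(q-1) columns. By a union bound
-- some column top x has, for every colour c, at least a 1/q fraction of the tops that are
-- not above x in coordinate c; an edge from x to the new vertex therefore discards
-- that fraction. After O(log n) edges (log₂ n if q = 2) all tops are discarded, so the new
-- vertex raises its column, which happens at most n^q times.
--
-- Painter keeps a large antichain of labels lo i that may be given away for free, each with
-- a label hi i above it that has not been used. An edge to the new vertex rules out at
-- most one i, and the most popular of the colours compatible with the others
-- keeps at least a 1/q fraction of them. So forcing the use of some new hi i costs about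
-- log_q of the size of the antichain. For q = 2 the antichains live in strips of n/K
-- columns for a large constant K, so that they exhaust almost all labels while log₂ (n/K)
-- is still (1 - o(1)) log₂ n.
module Submission where

open import Defs
open import Data.Nat
open import Data.Nat.DivMod
open import Data.Nat.Properties
open import Data.Nat.Tactic.RingSolver using (solve-∀)
open import Data.Fin using (Fin; zero; suc; toℕ; fromℕ<; combine; finToFun; funToFin)
open import Data.Fin.Properties as Fin using (toℕ<n; toℕ-fromℕ<; finToFun-funToFin)
open import Data.List using (List; []; _∷_; length; filter; allFin)
open import Data.List.Properties using (length-filter; length-tabulate; filter-none)
open import Data.List.Membership.Propositional using (_∈_; _∉_)
open import Data.List.Membership.Propositional.Properties using (∈-filter⁺; ∈-filter⁻; ∈-allFin)
open import Data.List.Relation.Unary.All as All using ()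
open import Data.List.Relation.Unary.AllPairs using (_∷_)
open import Data.List.Relation.Unary.Any using (here; there)
open import Data.List.Relation.Unary.Unique.Propositional using (Unique)
open import Data.List.Relation.Unary.Unique.Propositional.Properties using (allFin⁺; filter⁺)
open import Data.Product using (_×_; _,_; ∃; proj₁; proj₂; map₂)
open import Data.Sum using (inj₁; inj₂)
open import Function using (_∘_; id)
open import Level using (0ℓ)
open import Relation.Binary using (DecidableEquality)
open import Relation.Binary.PropositionalEquality using (_≡_; _≢_; refl; sym; trans; cong; cong₂; subst; subst₂)
open import Relation.Nullary using (¬_; yes; no; contradiction; ¬?)
open import Relation.Unary using (Pred; Decidable)

-- Function updates and counting in filtered lists

private variable
  A : Set

update : {B : Set} → DecidableEquality A → A → B → (A → B) → A → B
update _≟_ a b f x with x ≟ a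
... | yes _ = b
... | no _  = f x

module _ (_≟_ : DecidableEquality A) {B : Set} where
  update-same : ∀ a {b : B} f → update _≟_ a b f a ≡ b
  update-same a f with a ≟ a
  ... | yes _ = refl
  ... | no a≢a = contradiction refl a≢a

  update-other : ∀ a {b : B} f {x} → x ≢ a → update _≟_ a b f x ≡ f x
  update-other a f {x} x≢a with x ≟ a
  ... | yes x≡a = contradiction x≡a x≢a
  ... | no _ = refl

module _ {P Q : Pred A 0ℓ} (P? : Decidable P) (Q? : Decidable Q) where
  length-filter-mono : ∀ xs → (∀ {x} → x ∈ xs → P x → Q x) → length (filter P? xs) ≤ length (filter Q? xs)
  length-filter-mono [] P⊆Q = z≤n
  length-filter-mono (x ∷ xs) P⊆Q with P? x | Q? x
  ... | yes p | yes q = s≤s (length-filter-mono xs (P⊆Q ∘ there))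
  ... | yes p | no ¬q = contradiction (P⊆Q (here refl) p) ¬q
  ... | no ¬p | yes q = m≤n⇒m≤1+n (length-filter-mono xs (P⊆Q ∘ there))
  ... | no ¬p | no ¬q = length-filter-mono xs (P⊆Q ∘ there)

  length-filter-filter : ∀ xs → length (filter P? (filter Q? xs)) ≤ length (filter P? xs)
  length-filter-filter [] = z≤n
  length-filter-filter (x ∷ xs) with Q? x
  length-filter-filter (x ∷ xs) | yes q with P? x
  ... | yes p = s≤s (length-filter-filter xs)
  ... | no ¬p = length-filter-filter xs
  length-filter-filter (x ∷ xs) | no ¬q with P? x
  ... | yes p = m≤n⇒m≤1+n (length-filter-filter xs)
  ... | no ¬p = length-filter-filter xs

length-filter-∁ : {P : Pred A 0ℓ} (P? : Decidable P) → ∀ xs →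
  length (filter P? xs) + length (filter (¬? ∘ P?) xs) ≡ length xs
length-filter-∁ P? [] = refl
length-filter-∁ P? (x ∷ xs) with P? x
... | yes p = cong suc (length-filter-∁ P? xs)
... | no ¬p = trans (+-suc _ _) (cong suc (length-filter-∁ P? xs))

length-pos⇒∃∈ : (xs : List A) → 0 < length xs → ∃ (_∈ xs)
length-pos⇒∃∈ (x ∷ xs) _ = x , here refl

-- Discarding the elements bad for colour `zero` costs at most `t` of them, so more than `q * t`
-- remain for the other colours.
union-bound : ∀ q {B : Fin q → Pred A 0ℓ} (B? : ∀ c → Decidable (B c)) t xs →
  (∀ c → length (filter (B? c) xs) ≤ t) → q * t < length xs →
  ∃ λ x → x ∈ xs × ∀ c → ¬ B c x
union-bound zero B? t xs small 0<∣xs∣ = map₂ (_, λ ()) (length-pos⇒∃∈ xs 0<∣xs∣)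
union-bound (suc q) B? t xs small large
  with union-bound q (B? ∘ suc) t ys (λ c → ≤-trans (length-filter-filter (B? (suc c)) (¬? ∘ B? zero) xs) (small (suc c)))
         (+-cancelˡ-< t (q * t) (length ys) (<-≤-trans large
           (≤-trans (≤-reflexive (sym (length-filter-∁ (B? zero) xs))) (+-monoˡ-≤ _ (small zero)))))
  where ys = filter (¬? ∘ B? zero) xs
... | x , x∈ys , good = let x∈xs , ¬b = ∈-filter⁻ (¬? ∘ B? zero) x∈ys in
  x , x∈xs , λ { zero → ¬b ; (suc c) → good c }

maximiser : (g : A → ℕ) (xs : List A) → 0 < length xs → ∃ λ x → x ∈ xs × ∀ {y} → y ∈ xs → g y ≤ g x
maximiser g (x ∷ []) _ = x , here refl , λ { (here refl) → ≤-refl }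
maximiser g (x ∷ xs@(_ ∷ _)) _ with maximiser g xs z<s
... | m , m∈xs , max with ≤-total (g m) (g x)
... | inj₁ gm≤gx = x , here refl , λ { (here refl) → ≤-refl ; (there y∈xs) → ≤-trans (max y∈xs) gm≤gx }
... | inj₂ gx≤gm = m , there m∈xs , λ { (here refl) → gx≤gm ; (there y∈xs) → max y∈xs }

-- Elements balanced for several rankings at once

module _ (g : A → ℕ) (xs : List A) where

  above : A → List A
  above x = filter (λ y → g x <? g y) xs

  -- All elements with more than r s / (r + 1) others above them lie below the
  -- greatest of them, hence there are fewer than s / (r + 1) of them.
  few-have-many-above : ∀ r → 0 < length xs →
    suc r * length (filter (λ x → r * length xs <? suc r * length (above x)) xs) < length xs
  few-have-many-above r xs≢[] with length bad in eq
    where bad = filter (λ x → r * length xs <? suc r * length (above x)) xs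
  ... | zero = subst (_< length xs) (sym (*-zeroʳ r)) xs≢[]
  ... | suc b = subst (λ b → suc r * b < length xs) eq (+-cancelʳ-< (r * s) _ _ (begin-strict
    suc r * length bad + r * s               <⟨ +-monoʳ-< (suc r * length bad) many ⟩
    suc r * length bad + suc r * length (above x)   ≡⟨ *-distribˡ-+ (suc r) (length bad) _ ⟨
    suc r * (length bad + length (above x))         ≤⟨ *-monoʳ-≤ (suc r) (+-monoˡ-≤ _ bad-below) ⟩
    suc r * (length below + length (above x))       ≡⟨ cong (suc r *_) (+-comm (length below) _) ⟩
    suc r * (length (above x) + length below)       ≡⟨ cong (suc r *_) (length-filter-∁ (λ y → g x <? g y) xs) ⟩
    s + r * s ∎))
    where
    open ≤-Reasoning
    s = length xs
    bad? = λ x → r * length xs <? suc r * length (above x)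
    bad = filter bad? xs
    max = maximiser g bad (subst (0 <_) (sym eq) z<s)
    x = proj₁ max
    many = proj₂ (∈-filter⁻ bad? {xs = xs} (proj₁ (proj₂ max)))
    below = filter (¬? ∘ (λ y → g x <? g y)) xs
    bad-below : length bad ≤ length below
    bad-below = length-filter-mono bad? (¬? ∘ (λ y → g x <? g y)) xs
      (λ y∈xs by → ≤⇒≯ (proj₂ (proj₂ max) (∈-filter⁺ bad? y∈xs by)))

-- For each of the `suc r` rankings fewer than a `1 / (r + 1)` share of the elements are bad, so the
-- bad sets cannot cover `xs`.
balanced-element : ∀ r (g : Fin (suc r) → A → ℕ) xs → 0 < length xs →
  ∃ λ x → x ∈ xs × ∀ c → suc r * length (above (g c) xs x) ≤ r * length xs
balanced-element r g xs xs≢[] = map₂ (map₂ (λ good c → ≮⇒≥ (good c))) (union-bound (suc r) bad? t xs small large)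
  where
  bad? : ∀ c → Decidable _
  bad? c x = r * length xs <? suc r * length (above (g c) xs x)
  -- The largest integer with `suc r * t < length xs`.
  t = pred (length xs) / suc r
  small : ∀ c → length (filter (bad? c) xs) ≤ t
  small c = begin
    b                      ≡⟨ m*n/n≡m b (suc r) ⟨
    b * suc r / suc r      ≤⟨ /-monoˡ-≤ (suc r) (<⇒≤pred (subst (_< length xs) (*-comm (suc r) b) (few-have-many-above (g c) xs r xs≢[]))) ⟩
    t                      ∎
    where
    open ≤-Reasoning
    b = length (filter (bad? c) xs)
  large : suc r * t < length xs
  large = <-≤-trans (s≤s (subst (_≤ pred (length xs)) (*-comm t (suc r)) (m/n*n≤m _ (suc r))))
    (≤-reflexive (suc-pred (length xs) ⦃ >-nonZero xs≢[] ⦄))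

-- Builder's strategy

total : ∀ {P} → (Fin P → ℕ) → ℕ
total {zero}  f = 0
total {suc P} f = f zero + total (f ∘ suc)

total-mono : ∀ {P} {f g : Fin P → ℕ} → (∀ a → f a ≤ g a) → total f ≤ total g
total-mono {zero}  f≤g = z≤n
total-mono {suc P} f≤g = +-mono-≤ (f≤g zero) (total-mono (f≤g ∘ suc))

total-mono-< : ∀ {P} {f g : Fin P → ℕ} → (∀ a → f a ≤ g a) → ∀ a → f a < g a → total f < total g
total-mono-< f≤g zero    fa<ga = +-mono-<-≤ fa<ga (total-mono (f≤g ∘ suc))
total-mono-< f≤g (suc a) fa<ga = +-mono-≤-< (f≤g zero) (total-mono-< (f≤g ∘ suc) a fa<ga)

total-bounded : ∀ {P N} {f : Fin P → ℕ} → (∀ a → f a ≤ N) → total f ≤ P * N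
total-bounded {zero}  f≤N = z≤n
total-bounded {suc P} f≤N = +-mono-≤ (f≤N zero) (total-bounded (f≤N ∘ suc))

MonoPath-∷ : ∀ {q} {E : Edges q} {c l v e} → MonoPath E c l v → MonoPath (e ∷ E) c l v
MonoPath-∷ (single v)   = single v
MonoPath-∷ (extend p e) = extend (MonoPath-∷ p) (there e)

Forces-mono : ∀ {q n k k′ cur E} → k ≤ k′ → Forces q n k cur E → Forces q n k′ cur E
Forces-mono k≤k′ (win p) = win p
Forces-mono (s≤s k≤k′) (draw i i<cur new f) = draw i i<cur new (λ c → Forces-mono k≤k′ (f c))
Forces-mono k≤k′ (next f) = next (Forces-mono k≤k′ f)

-- With `b = cur` this says that the current vertex has no edges yet, so all of builder's planned
-- draws are legal.
EdgesBelow : ∀ {q} → ℕ → Edges q → Set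
EdgesBelow b E = ∀ {i j c} → (i , j , c) ∈ E → j < b

-- There are `suc r` colours and the target is `suc N` vertices, so labels have entries from 1 to
-- `N` until builder has won.
module Builder (r N : ℕ) (0<N : 0 < N) where

  Column Label : Set
  Column = Fin (N ^ r)
  Label = Fin (suc r) → ℕ

  -- A column fixes the coordinates suc c of a label; coordinate zero is its height.
  label : (Column → ℕ) → Column → Label
  label h a zero    = h a
  label h a (suc c) = suc (toℕ (finToFun a c))

  -- v a is a vertex ending monochromatic paths whose lengths are the highest label
  -- seen in column a; height 0 means that column a is still empty.
  record Board (cur : ℕ) (E : Edges (suc r)) (h v : Column → ℕ) : Set where
    field
      bounded  : ∀ a → h a ≤ N
      older    : ∀ a → 0 < h a → v a < cur
      distinct : ∀ {a b} → 0 < h a → 0 < h b → v a ≡ v b → a ≡ b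
      path     : ∀ a → 0 < h a → ∀ c → MonoPath E c (label h a c) (v a)

    label-bounded : ∀ a c → label h a c ≤ N
    label-bounded a zero    = bounded a
    label-bounded a (suc c) = toℕ<n (finToFun a c)

  open Board

  Board-∷ : ∀ {cur E h v e} → Board cur E h v → Board cur (e ∷ E) h v
  Board-∷ B = record
    { bounded = bounded B ; older = older B ; distinct = distinct B
    ; path = λ a 0<ha c → MonoPath-∷ (path B a 0<ha c) }

  -- The new vertex has label `suc (ℓ c)` in colour `c`, so `ℓ c < label h a c` for all `c` means
  -- that the top of column `a` is weakly above it. `finish` is the continuation, with `k` edges,
  -- once no top is.
  module _ {cur k : ℕ} {h v : Column → ℕ}
    (finish : ∀ {E} {ℓ : Label} → Board cur E h v → EdgesBelow (suc cur) E →
      (∀ c → ℓ c < N) → (∀ c → MonoPath E c (suc (ℓ c)) cur) →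
      (∀ a → ¬ (∀ c → ℓ c < label h a c)) → Forces (suc r) (suc N) k cur E) where

    -- `R` lists the columns whose tops are still weakly above the new label. An edge to a balanced
    -- top shrinks `R` by a factor of at least `r / (r + 1)`, whatever its colour, so the last
    -- hypothesis ensures that `j` edges empty it.
    stage : ∀ j R {E} {ℓ : Label} → Board cur E h v → EdgesBelow (suc cur) E →
      (∀ c → ℓ c < N) → (∀ c → MonoPath E c (suc (ℓ c)) cur) →
      (∀ {a} → (∀ c → ℓ c < label h a c) → a ∈ R) →
      (∀ {a} → a ∈ R → ∀ c → ℓ c < label h a c) →
      (∀ {a} → a ∈ R → ∀ c → (v a , cur , c) ∉ E) →
      length R * r ^ j < suc r ^ j → Forces (suc r) (suc N) (j + k) cur E
    stage j [] B below ℓ<N paths complete _ _ _ =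
      Forces-mono (m≤n+m k j) (finish B below ℓ<N paths λ a dom → contradiction (complete dom) λ ())
    stage zero (_ ∷ _) B below ℓ<N paths complete sound new (s≤s ())
    stage (suc j) R@(_ ∷ _) {E} {ℓ} B below ℓ<N paths complete sound new short
      with balanced-element r (λ c a → label h a c) R z<s
    ... | x , x∈R , balanced = draw (v x) (older B x 0<hx) (new x∈R) answer
      where
      0<h : ∀ {a} → a ∈ R → 0 < h a
      0<h a∈R = m<n⇒0<n (sound a∈R zero)
      0<hx = 0<h x∈R
      answer : ∀ c → Forces (suc r) (suc N) (j + k) cur ((v x , cur , c) ∷ E)
      answer c with m≤n⇒m<n∨m≡n (label-bounded B x c)
      ... | inj₂ lx≡N = win (c , cur , subst (λ l → MonoPath _ c (suc l) cur) lx≡N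
              (extend (MonoPath-∷ (path B x 0<hx c)) (here refl)))
      ... | inj₁ lx<N = stage j R′ (Board-∷ B) below′ ℓ′<N paths′ complete′ sound′ new′ short′
        where
        E′ = (v x , cur , c) ∷ E
        ℓ′ = update Fin._≟_ c (label h x c) ℓ
        taller? = λ y → label h x c <? label h y c
        R′ = above (λ a → label h a c) R x
        below′ : EdgesBelow (suc cur) E′
        below′ (here refl) = ≤-refl
        below′ (there e)   = below e
        ℓ′<N : ∀ c′ → ℓ′ c′ < N
        ℓ′<N c′ with c′ Fin.≟ c
        ... | yes _ = lx<N
        ... | no _  = ℓ<N c′
        paths′ : ∀ c′ → MonoPath E′ c′ (suc (ℓ′ c′)) cur
        paths′ c′ with c′ Fin.≟ c
        ... | yes refl = extend (MonoPath-∷ (path B x 0<hx c)) (here refl)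
        ... | no _     = MonoPath-∷ (paths c′)
        ℓ≤ℓ′ : ∀ c′ → ℓ c′ ≤ ℓ′ c′
        ℓ≤ℓ′ c′ with c′ Fin.≟ c
        ... | yes refl = <⇒≤ (sound x∈R c)
        ... | no _     = ≤-refl
        complete′ : ∀ {a} → (∀ c → ℓ′ c < label h a c) → a ∈ R′
        complete′ {a} dom = ∈-filter⁺ taller? (complete λ c → ≤-<-trans (ℓ≤ℓ′ c) (dom c))
          (subst (_< label h a c) (update-same Fin._≟_ c ℓ) (dom c))
        sound′ : ∀ {a} → a ∈ R′ → ∀ c′ → ℓ′ c′ < label h a c′
        sound′ a∈R′ c′ with ∈-filter⁻ taller? {xs = R} a∈R′
        ... | a∈R , lx<la with c′ Fin.≟ c
        ... | yes refl = lx<la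
        ... | no _     = sound a∈R c′
        -- Tops of different columns are different vertices, and `a` is not `x` because its label in
        -- colour `c` is strictly larger.
        new′ : ∀ {a} → a ∈ R′ → ∀ c′ → (v a , cur , c′) ∉ E′
        new′ {a} a∈R′ c′ with ∈-filter⁻ taller? {xs = R} a∈R′
        ... | a∈R , lx<la = λ where
          (there e) → new a∈R c′ e
          (here eq) → <-irrefl (cong (λ a → label h a c) (distinct B 0<hx (0<h a∈R) (sym (cong proj₁ eq)))) lx<la
        short′ : length R′ * r ^ j < suc r ^ j
        short′ = *-cancelˡ-< (suc r) _ _ (begin-strict
          suc r * (length R′ * r ^ j)   ≡⟨ *-assoc (suc r) (length R′) _ ⟨
          suc r * length R′ * r ^ j     ≤⟨ *-monoˡ-≤ (r ^ j) (balanced c) ⟩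
          r * length R * r ^ j          ≡⟨ cong (_* r ^ j) (*-comm r (length R)) ⟩
          length R * r * r ^ j          ≡⟨ *-assoc (length R) r _ ⟩
          length R * r ^ suc j          <⟨ short ⟩
          suc r ^ suc j                 ∎)
          where open ≤-Reasoning

  -- The coordinates `suc c` of the new label select a column `a`. If that column were already at
  -- least as tall, its top would be weakly above the new label. Hence making the new vertex its top
  -- increases the total height.
  raise : ∀ {cur E h v} {ℓ : Label} → Board cur E h v →
    (ℓ<N : ∀ c → ℓ c < N) → (∀ c → MonoPath E c (suc (ℓ c)) cur) →
    (∀ a → ¬ (∀ c → ℓ c < label h a c)) →
    ∃ λ h′ → ∃ λ v′ → Board (suc cur) E h′ v′ × total h < total h′
  raise {cur} {E} {h} {v} {ℓ} B ℓ<N paths undominated =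
    h′ , v′ , record { bounded = bounded′ ; older = older′ ; distinct = distinct′ ; path = path′ } ,
    total-mono-< h≤h′ a (subst (h a <_) (sym (update-same Fin._≟_ a h)) ha<)
    where
    digits : Fin r → Fin N
    digits c = fromℕ< (ℓ<N (suc c))
    a = funToFin digits
    label-a : ∀ c → label h a (suc c) ≡ suc (ℓ (suc c))
    label-a c = cong suc (trans (cong toℕ (finToFun-funToFin digits c)) (toℕ-fromℕ< _))
    ha< : h a < suc (ℓ zero)
    ha< = ≰⇒> λ ℓ<ha → undominated a λ
      { zero → ℓ<ha ; (suc c) → ≤-reflexive (sym (label-a c)) }
    h′ = update Fin._≟_ a (suc (ℓ zero)) h
    v′ = update Fin._≟_ a cur v
    h≤h′ : ∀ b → h b ≤ h′ b
    h≤h′ b with b Fin.≟ a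
    ... | yes refl = <⇒≤ ha<
    ... | no _     = ≤-refl
    bounded′ : ∀ b → h′ b ≤ N
    bounded′ b with b Fin.≟ a
    ... | yes _ = ℓ<N zero
    ... | no _  = bounded B b
    older′ : ∀ b → 0 < h′ b → v′ b < suc cur
    older′ b with b Fin.≟ a
    ... | yes _ = λ _ → ≤-refl
    ... | no _  = m<n⇒m<1+n ∘ older B b
    distinct′ : ∀ {b d} → 0 < h′ b → 0 < h′ d → v′ b ≡ v′ d → b ≡ d
    distinct′ {b} {d} with b Fin.≟ a | d Fin.≟ a
    ... | yes b≡a | yes d≡a = λ _ _ _ → trans b≡a (sym d≡a)
    ... | yes _ | no _ = λ _ 0<hd cur≡vd → contradiction (sym cur≡vd) (<⇒≢ (older B d 0<hd))
    ... | no _ | yes _ = λ 0<hb _ vb≡cur → contradiction vb≡cur (<⇒≢ (older B b 0<hb))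
    ... | no _ | no _ = distinct B
    path′ : ∀ b → 0 < h′ b → ∀ c → MonoPath E c (label h′ b c) (v′ b)
    path′ b 0<hb zero with b Fin.≟ a
    ... | yes _ = paths zero
    ... | no _  = path B b 0<hb zero
    path′ b 0<hb (suc c) with b Fin.≟ a
    ... | yes refl = subst (λ l → MonoPath E (suc c) l cur) (sym (label-a c)) (paths (suc c))
    ... | no _     = path B b 0<hb (suc c)

  module _ (J : ℕ) (enough : N ^ r * r ^ J < suc r ^ J) where

    -- The total height never exceeds `N ^ r * N`, so at most `u` raises remain. Each round costs at
    -- most `J` edges; the extra one is the round whose raise is impossible, so that it must end in
    -- a win.
    rounds : ∀ u {cur E h v} → Board cur E h v → EdgesBelow cur E →
      N ^ r * N ≤ u + total h → Forces (suc r) (suc N) (suc u * J) cur E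
    rounds u {cur} {E} {h} {v} B below potential =
      -- A vertex without edges has label 1 in every colour, and the tops weakly above it are those
      -- of all nonempty columns.
      stage (finish u potential) J occupied B (m<n⇒m<1+n ∘ below) (λ _ → 0<N) (λ _ → single cur)
        (λ dom → ∈-filter⁺ occupied? (∈-allFin _) (dom zero))
        (λ { a∈ zero → proj₂ (∈-filter⁻ occupied? {xs = allFin _} a∈) ; a∈ (suc c) → z<s })
        (λ _ c e → <-irrefl refl (below e))
        (≤-<-trans (*-monoˡ-≤ (r ^ J) (≤-trans (length-filter occupied? (allFin _)) (≤-reflexive (length-tabulate {n = N ^ r} id)))) enough)
      where
      occupied? : Decidable (λ a → 0 < h a)
      occupied? a = 0 <? h a
      occupied = filter occupied? (allFin (N ^ r))
      finish : ∀ u → N ^ r * N ≤ u + total h → ∀ {E} {ℓ : Label} → Board cur E h v → EdgesBelow (suc cur) E →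
        (∀ c → ℓ c < N) → (∀ c → MonoPath E c (suc (ℓ c)) cur) →
        (∀ a → ¬ (∀ c → ℓ c < label h a c)) → Forces (suc r) (suc N) (u * J) cur E
      finish u pot B below ℓ<N paths undominated with raise B ℓ<N paths undominated
      finish zero pot B below ℓ<N paths undominated | h′ , v′ , B′ , h<h′ =
        contradiction (total-bounded (bounded B′)) (<⇒≱ (≤-<-trans pot h<h′))
      finish (suc u) pot B below ℓ<N paths undominated | h′ , v′ , B′ , h<h′ =
        next (rounds u B′ below (≤-trans pot (≤-trans (≤-reflexive (sym (+-suc u _))) (+-monoʳ-≤ u h<h′))))

    builder-wins : BuilderWinsWithin (suc r) (suc N) (suc (N ^ r * N) * J)
    builder-wins = rounds (N ^ r * N) {h = λ _ → 0} {v = λ _ → 0}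
      (record { bounded = λ _ → z≤n ; older = λ _ () ; distinct = λ () ; path = λ _ () }) (λ ()) (m≤m+n _ _)

-- Painter's strategy

module _ (_≟_ : DecidableEquality A) where
  length-remove : ∀ a {xs} → Unique xs → length xs ≤ suc (length (filter (¬? ∘ (_≟ a)) xs))
  length-remove a {[]} _ = z≤n
  length-remove a {x ∷ xs} (x∉xs ∷ unique) with x ≟ a
  ... | no _ = s≤s (length-remove a unique)
  ... | yes refl = s≤s (≤-trans (≤-reflexive (sym (length-filter-∁ (_≟ x) xs)))
    (+-monoˡ-≤ _ (≤-reflexive (cong length (filter-none (_≟ x) (All.map (λ x≢y y≡x → x≢y (sym y≡x)) x∉xs))))))

-- Pigeonhole: if no colour were popular, `union-bound` would produce an uncoloured element.
popular-colour : ∀ q {B : Fin q → Pred A 0ℓ} (B? : ∀ c → Decidable (B c)) t xs →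
  (∀ {x} → x ∈ xs → ∃ λ c → B c x) → q * t < length xs → ∃ λ c → t < length (filter (B? c) xs)
popular-colour q B? t xs coloured large with Fin.any? (λ c → t <? length (filter (B? c) xs))
... | yes popular = popular
... | no ¬popular with union-bound q B? t xs (λ c → ≮⇒≥ (¬popular ∘ (c ,_))) large
... | x , x∈xs , uncoloured = let c , b = coloured x∈xs in contradiction b (uncoloured c)

-- Painter's labels start at 0: `suc (f v c)` bounds the number of vertices on a path of colour `c`
-- ending at `v`.
Proper : ∀ {q} → Edges q → (ℕ → Fin q → ℕ) → ℕ → Set
Proper E f cur = ∀ {i j c} → (i , j , c) ∈ E → i < j × j ≤ cur × f i c < f j c

Bounded : ∀ {q} → ℕ → (ℕ → Fin q → ℕ) → Set
Bounded n f = ∀ v c → suc (f v c) < n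

Proper⇒¬HasMonoPath : ∀ {q n cur} {E : Edges q} {f} → Bounded n f → Proper E f cur → ¬ HasMonoPath q n E
Proper⇒¬HasMonoPath {E = E} {f} bounded proper (c , v , p) = <⇒≱ (bounded v c) (short p)
  where
  short : ∀ {l v} → MonoPath E c l v → l ≤ suc (f v c)
  short (single v)   = s≤s z≤n
  short (extend p e) = s≤s (≤-trans (short p) (proj₂ (proj₂ (proper e))))

-- In sweep s the painter may give a new vertex the label lo s i as often as wanted,
-- but hi s i only once.
record Sweeps (q n M S : ℕ) : Set where
  field
    lo hi     : ℕ → Fin M → Fin q → ℕ
    lo≤hi     : ∀ s i c → lo s i c ≤ hi s i c
    lo<hi     : ∀ s i → ∃ λ c → lo s i c < hi s i c
    hi-bound  : ∀ {s} → s < S → ∀ i c → suc (hi s i c) < n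
    -- No label of another column from this or an earlier sweep is weakly above `lo s i`, so an
    -- earlier vertex can obstruct only its own column.
    separated : ∀ {s s′ i j} → s′ ≤ s → i ≢ j → ∃ λ c → hi s′ j c < lo s i c
    growing   : ∀ {s s′} → s′ < s → ∀ i → ∃ λ c → hi s′ i c < hi s i c

-- Painter charges `L` edges for each of `suc D` uses of a label `hi` in each of `suc ρ` sweeps. The
-- other `2 * q ^ L` columns are a reserve that keeps the set of candidates large at the start of
-- every stage.
module Painter {q n L D ρ : ℕ} (1<q : 1 < q) (1<n : 1 < n)
  (sweeps : Sweeps q n (2 * q ^ L + suc D) (suc ρ)) where

  open Sweeps sweeps

  M : ℕ
  M = 2 * q ^ L + suc D

  suc-pred-2q^ : ∀ l → suc (pred (2 * q ^ l)) ≡ 2 * q ^ l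
  suc-pred-2q^ l = suc-pred (2 * q ^ l) ⦃ m*n≢0 2 (q ^ l) ⦃ _ ⦄ ⦃ m^n≢0 q l ⦃ >-nonZero (<⇒≤ 1<q) ⦄ ⦄ ⦄

  -- C lists the columns whose label hi s j is still unused.
  Placed : ℕ → List (Fin M) → (Fin q → ℕ) → Set
  Placed s C x = ∃ λ s′ → ∃ λ j → s′ ≤ s × (∀ c → x c ≤ hi s′ j c) × (s′ ≡ s → j ∈ C → ∀ c → x c ≤ lo s j c)

  Placed-⊆ : ∀ {s C C′ x} → (∀ {i} → i ∈ C′ → i ∈ C) → Placed s C x → Placed s C′ x
  Placed-⊆ C′⊆C (s′ , j , s′≤s , x≤hi , x≤lo) = s′ , j , s′≤s , x≤hi , λ s′≡s j∈ → x≤lo s′≡s (C′⊆C j∈)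

  Placed-suc : ∀ {s C C′ x} → Placed s C x → Placed (suc s) C′ x
  Placed-suc (s′ , j , s′≤s , x≤hi , _) = s′ , j , m≤n⇒m≤1+n s′≤s , x≤hi , λ { refl → contradiction s′≤s 1+n≰n }

  Placed-lo : ∀ {s C} i → Placed s C (lo s i)
  Placed-lo {s} i = s , i , ≤-refl , lo≤hi s i , λ _ _ c → ≤-refl

  conflict : ∀ {s C x} → Placed s C x →
    ∃ λ j → (∀ {i} → i ≢ j → ∃ λ c → x c < lo s i c) × (j ∈ C → ∃ λ c → x c < hi s j c)
  conflict {s} {C} {x} (s′ , j , s′≤s , x≤hi , x≤lo) = j ,
    (λ i≢j → map₂ (≤-<-trans (x≤hi _)) (separated s′≤s i≢j)) , room
    where
    room : j ∈ C → ∃ λ c → x c < hi s j c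
    room j∈C with m≤n⇒m<n∨m≡n s′≤s
    ... | inj₁ s′<s = map₂ (≤-<-trans (x≤hi _)) (growing s′<s j)
    ... | inj₂ s′≡s = map₂ (≤-<-trans (x≤lo s′≡s j∈C _)) (lo<hi s j)

  record Position (cur s : ℕ) (C : List (Fin M)) (f : ℕ → Fin q → ℕ) : Set where
    constructor position
    field
      unique  : Unique C
      placed  : ∀ {v} → v < cur → Placed s C (f v)
      bounded : Bounded n f

  open Position

  relabel : ℕ → (Fin q → ℕ) → (ℕ → Fin q → ℕ) → ℕ → Fin q → ℕ
  relabel = update _≟_

  relabel-bounded : ∀ {cur s ρ′ f} → s + ρ′ ≡ ρ → Bounded n f → ∀ i {x} → (∀ c → x c ≤ hi s i c) → Bounded n (relabel cur x f)
  relabel-bounded {cur} {s} {ρ′} sρ bounded i x≤hi v c with v ≟ cur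
  ... | yes _ = ≤-<-trans (s≤s (x≤hi c)) (hi-bound (s≤s (subst (s ≤_) sρ (m≤m+n s ρ′))) i c)
  ... | no _  = bounded v c

  relabel-placed : ∀ {cur s C C′ f x} → (∀ {v} → v < cur → Placed s C (f v)) → (∀ {i} → i ∈ C′ → i ∈ C) → Placed s C′ x →
    ∀ {v} → v < suc cur → Placed s C′ (relabel cur x f v)
  relabel-placed {cur} placed C′⊆C px {v} v<1+cur with v ≟ cur
  ... | yes _   = px
  ... | no v≢cur = Placed-⊆ C′⊆C (placed (≤∧≢⇒< (≤-pred v<1+cur) v≢cur))

  -- Edges may end at `cur` but never start there, so raising its label destroys no increase.
  relabel-proper : ∀ {cur} {E : Edges q} {f x y} → (∀ c → x c ≤ y c) → Proper E (relabel cur x f) cur → Proper E (relabel cur y f) cur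
  relabel-proper {cur} {f = f} {x} {y} x≤y proper {i} {j} {c} e with proper e
  ... | i<j , j≤cur , fi<fj = i<j , j≤cur ,
    subst (_< relabel cur y f j c) (cong (λ x → x c) (trans (update-other _≟_ cur f i≢cur) (sym (update-other _≟_ cur f i≢cur))))
      (<-≤-trans fi<fj relabel-mono)
    where
    i≢cur = <⇒≢ (<-≤-trans i<j j≤cur)
    relabel-mono : relabel cur x f j c ≤ relabel cur y f j c
    relabel-mono with j ≟ cur
    ... | yes _ = x≤y c
    ... | no _  = ≤-refl

  relabel-next : ∀ {cur} {E : Edges q} {f x} → Proper E f cur → Proper E (relabel (suc cur) x f) (suc cur)
  relabel-next {cur} {E = E} {f} {x} proper {i} {j} {c} e with proper e
  ... | i<j , j≤cur , fi<fj = i<j , m≤n⇒m≤1+n j≤cur ,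
    subst₂ _<_ (cong (λ x → x c) (sym (update-other _≟_ (suc cur) f (<⇒≢ (s≤s (<⇒≤ (<-≤-trans i<j j≤cur)))))))
               (cong (λ x → x c) (sym (update-other _≟_ (suc cur) f (<⇒≢ (s≤s j≤cur))))) fi<fj

  Proper-∷ : ∀ {cur} {E : Edges q} {f i c} → i < cur → f i c < f cur c → Proper E f cur → Proper ((i , cur , c) ∷ E) f cur
  Proper-∷ i<cur fi<f proper (here refl) = i<cur , ≤-refl , fi<f
  Proper-∷ i<cur fi<f proper (there e)   = proper e

  -- `d` charged uses remain in the current sweep, and `ρ′` full sweeps follow it.
  cost : ℕ → ℕ → ℕ
  cost ρ′ d = L * (d + ρ′ * suc D)

  -- The label of the current vertex has been fixed.
  decided : ∀ {k cur E s C f} ρ′ d → Forces q n k cur E → s + ρ′ ≡ ρ → 2 * q ^ L + d ≤ length C →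
    Position cur s C f → Placed s C (f cur) → (∀ {v} → v < cur → ∃ λ c → f v c < f cur c) → Proper E f cur →
    cost ρ′ d ≤ k

  -- The label of the current vertex will be lo s i or hi s i for some i in I.
  undecided : ∀ {k cur E s C f} ρ′ d l I → Forces q n k cur E → s + ρ′ ≡ ρ → 2 * q ^ L + suc d ≤ length C →
    Position cur s C f → l ≤ L → Unique I → (∀ {i} → i ∈ I → i ∈ C) → 2 * q ^ l ≤ length I →
    (∀ {i} → i ∈ I → Proper E (relabel cur (lo s i) f) cur) → l + cost ρ′ d ≤ k

  new-vertex : ∀ {k cur E s C f} ρ′ d → Forces q n k (suc cur) E → s + ρ′ ≡ ρ → 2 * q ^ L + suc d ≤ length C →
    Position (suc cur) s C f → Proper E f cur → L + cost ρ′ d ≤ k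
  new-vertex ρ′ d F sρ large pos proper =
    undecided ρ′ d L _ F sρ large pos ≤-refl (unique pos) id (≤-trans (m≤m+n _ _) large) (λ _ → relabel-next proper)

  decided ρ′ d (win p) sρ large pos pc below proper = contradiction p (Proper⇒¬HasMonoPath (bounded pos) proper)
  decided ρ′ d (draw i i<cur _ F) sρ large pos pc below proper with below i<cur
  ... | c , fi<f = m≤n⇒m≤1+n (decided ρ′ d (F c) sρ large pos pc below (Proper-∷ i<cur fi<f proper))
  decided {k} {cur} {E} {s} {C} {f} ρ′ d (next F) sρ large pos pc below proper = go ρ′ d sρ large
    where
    all-placed : ∀ {v} → v < suc cur → Placed s C (f v)
    all-placed {v} v<1+cur with m≤n⇒m<n∨m≡n (≤-pred v<1+cur)
    ... | inj₁ v<cur = placed pos v<cur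
    ... | inj₂ refl = pc
    go : ∀ ρ′ d → s + ρ′ ≡ ρ → 2 * q ^ L + d ≤ length C → cost ρ′ d ≤ k
    go ρ′ (suc d) sρ large = subst (_≤ k) (sym (*-suc L _)) (new-vertex ρ′ d F sρ large
      (position (unique pos) all-placed (bounded pos)) proper)
    go zero zero sρ large = subst (_≤ k) (sym (*-zeroʳ L)) z≤n
    go (suc ρ′) zero sρ large = subst (_≤ k) (sym (*-suc L _)) (new-vertex {C = allFin M} ρ′ D F (trans (sym (+-suc s ρ′)) sρ)
      (≤-reflexive (sym (length-tabulate {n = M} id)))
      (position (allFin⁺ M) (Placed-suc ∘ all-placed) (bounded pos)) proper)

  -- The charge has been paid: the vertex receives `hi s i` for a surviving `i`, which is not weakly
  -- below any earlier label, and column `i` becomes used.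
  undecided {k} {cur} {E} {s} {C} {f} ρ′ d zero I F sρ large pos l≤L uI I⊆C many proper
    with length-pos⇒∃∈ I (≤-trans (s≤s z≤n) many)
  ... | i , i∈I = decided {f = f′} ρ′ d F sρ
      (≤-pred (≤-trans (≤-reflexive (sym (+-suc _ d))) (≤-trans large (length-remove Fin._≟_ i (unique pos)))))
      (position (filter⁺ _ (unique pos))
        (λ v<cur → relabel-placed (placed pos) C′⊆C placed-hi (m<n⇒m<1+n v<cur))
        (relabel-bounded sρ (bounded pos) i (λ _ → ≤-refl)))
      (relabel-placed (placed pos) C′⊆C placed-hi ≤-refl) below (relabel-proper (lo≤hi s i) (proper i∈I))
    where
    f′ = relabel cur (hi s i) f
    C′ = filter (¬? ∘ (Fin._≟ i)) C
    C′⊆C : ∀ {j} → j ∈ C′ → j ∈ C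
    C′⊆C = proj₁ ∘ ∈-filter⁻ (¬? ∘ (Fin._≟ i))
    placed-hi : Placed s C′ (hi s i)
    placed-hi = s , i , ≤-refl , (λ _ → ≤-refl) , λ _ i∈C′ → contradiction refl (proj₂ (∈-filter⁻ (¬? ∘ (Fin._≟ i)) {xs = C} i∈C′))
    below : ∀ {v} → v < cur → ∃ λ c → f′ v c < f′ cur c
    below {v} v<cur with conflict (placed pos v<cur)
    ... | j , others , same = subst₂ (λ x y → ∃ λ c → x c < y c)
      (sym (update-other _≟_ cur f (<⇒≢ v<cur))) (sym (update-same _≟_ cur f)) free
      where
      free : ∃ λ c → f v c < hi s i c
      free with i Fin.≟ j
      ... | yes refl = same (I⊆C i∈I)
      ... | no i≢j   = map₂ (λ fv<lo → <-≤-trans fv<lo (lo≤hi s i _)) (others i≢j)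
  undecided {cur = cur} {E} {s} {C} {f} ρ′ d (suc l) I F sρ large pos l≤L uI I⊆C many proper
    with length-pos⇒∃∈ I (≤-trans (m^n>0 q ⦃ >-nonZero (<⇒≤ 1<q) ⦄ (suc l)) (≤-trans (m≤m+n _ _) many))
  undecided {cur = cur} {E} {s} {C} {f} ρ′ d (suc l) I (win p) sρ large pos l≤L uI I⊆C many proper | i , i∈I =
    contradiction p (Proper⇒¬HasMonoPath (relabel-bounded sρ (bounded pos) i (lo≤hi s i)) (proper i∈I))
  -- Builder stopped early, so the vertex receives `lo s i`. No column is used up, and the charge
  -- starts again from the full `L`.
  undecided {cur = cur} {E} {s} {C} {f} ρ′ d (suc l) I (next F) sρ large pos l≤L uI I⊆C many proper | i , i∈I =
    ≤-trans (+-monoˡ-≤ _ l≤L) (new-vertex ρ′ d F sρ large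
      (position (unique pos) (relabel-placed (placed pos) id (Placed-lo i))
        (relabel-bounded sρ (bounded pos) i (lo≤hi s i)))
      (proper i∈I))
  undecided {cur = cur} {E} {s} {C} {f} ρ′ d (suc l) I (draw v v<cur _ F) sρ large pos l≤L uI I⊆C many proper | _
    with conflict (placed pos v<cur)
  ... | j , others , _
    with popular-colour q (λ c i → f v c <? lo s i c) (pred (2 * q ^ l)) (filter (¬? ∘ (Fin._≟ j)) I)
           (λ i∈I′ → others (proj₂ (∈-filter⁻ (¬? ∘ (Fin._≟ j)) {xs = I} i∈I′)))
           remaining
    where
    I′ = filter (¬? ∘ (Fin._≟ j)) I
    t = pred (2 * q ^ l)
    -- Dropping the column `j` of `v` loses at most one candidate. As `q` is at least 2, enough
    -- remain for some colour to keep more than `t`, that is, at least `2 * q ^ l`.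
    remaining : q * t < length I′
    remaining = ≤-pred (begin
      2 + q * t            ≤⟨ +-monoˡ-≤ (q * t) 1<q ⟩
      q + q * t            ≡⟨ *-suc q t ⟨
      q * suc t            ≡⟨ cong (q *_) (suc-pred-2q^ l) ⟩
      q * (2 * q ^ l)      ≡⟨ *-assoc q 2 (q ^ l) ⟨
      q * 2 * q ^ l        ≡⟨ cong (_* q ^ l) (*-comm q 2) ⟩
      2 * q * q ^ l        ≡⟨ *-assoc 2 q (q ^ l) ⟩
      2 * q ^ suc l        ≤⟨ many ⟩
      length I             ≤⟨ length-remove Fin._≟_ j uI ⟩
      suc (length I′)      ∎)
      where open ≤-Reasoning
  ... | c , popular = s≤s (undecided ρ′ d l _ (F c) sρ large pos (<⇒≤ l≤L) (filter⁺ _ (filter⁺ _ uI))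
      (I⊆C ∘ ⊆I) (≤-trans (≤-reflexive (sym (suc-pred-2q^ l))) popular) proper′)
    where
    I′ = filter (¬? ∘ (Fin._≟ j)) I
    I″ = filter (λ i → f v c <? lo s i c) I′
    ⊆I : ∀ {i} → i ∈ I″ → i ∈ I
    ⊆I = proj₁ ∘ ∈-filter⁻ (¬? ∘ (Fin._≟ j)) ∘ proj₁ ∘ ∈-filter⁻ (λ i → f v c <? lo s i c)
    proper′ : ∀ {i} → i ∈ I″ → Proper ((v , cur , c) ∷ E) (relabel cur (lo s i) f) cur
    proper′ {i} i∈I″ = Proper-∷ v<cur
      (subst₂ (λ x y → x c < y c) (sym (update-other _≟_ cur f (<⇒≢ v<cur))) (sym (update-same _≟_ cur f))
        (proj₂ (∈-filter⁻ (λ i → f v c <? lo s i c) {xs = I′} i∈I″)))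
      (proper (⊆I i∈I″))

  painter-survives : ∀ {k} → BuilderWinsWithin q n k → L * (suc ρ * suc D) ≤ k
  painter-survives {k} F = subst (_≤ k) (sym (*-suc L _)) (undecided {s = 0} {C = allFin M} {f = λ _ _ → 0} ρ D L (allFin M) F refl
    (≤-reflexive (sym (length-tabulate {n = M} id))) (position (allFin⁺ M) (λ ()) (λ _ _ → 1<n)) ≤-refl (allFin⁺ M) id
    (≤-trans (m≤m+n _ _) (≤-reflexive (sym (length-tabulate {n = M} id)))) (λ _ ()))

-- Antichains of labels arranged in strips

funToFin-cong : ∀ {m n} {f g : Fin m → Fin n} → (∀ c → f c ≡ g c) → funToFin f ≡ funToFin g
funToFin-cong {zero}  f≗g = refl
funToFin-cong {suc m} f≗g = cong₂ combine (f≗g zero) (funToFin-cong (f≗g ∘ suc))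

module Strips (r w T N : ℕ) ⦃ _ : NonZero T ⦄ where

  digits : Fin (w ^ suc r) → Fin (suc r) → Fin w
  digits = finToFun

  digit : Fin (w ^ suc r) → Fin (suc r) → ℕ
  digit i c = toℕ (digits i c)

  defect : Fin (w ^ suc r) → ℕ
  defect i = total λ c → w ∸ suc (digit i c)

  -- Sweep `s` is number `s % T` in strip `s / T`. The coordinates `suc c` locate a cell in the box
  -- of that strip, and coordinate `zero` falls as the digits grow, which makes each sweep an
  -- antichain. Doubling the defect leaves a gap for `high`.
  low high : ℕ → Fin (w ^ suc r) → Fin (2 + r) → ℕ
  low s i zero     = 2 * defect i + s % T
  low s i (suc c)  = s / T * w + digit i c
  high s i zero    = suc (low s i zero)
  high s i (suc c) = low s i (suc c)

  digit-injective : ∀ {i j} → (∀ c → digit i c ≡ digit j c) → i ≡ j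
  digit-injective {i} {j} eq = trans (sym (Fin.funToFin-finToFin {suc r} {w} i))
    (trans (funToFin-cong λ c → Fin.toℕ-injective (eq c)) (Fin.funToFin-finToFin {suc r} {w} j))

  defect-< : ∀ {i j} → i ≢ j → (∀ c → digit i c ≤ digit j c) → defect j < defect i
  defect-< {i} {j} i≢j i≤j with Fin.¬∀⟶∃¬ (suc r) (λ c → digit i c ≡ digit j c) (λ c → digit i c ≟ digit j c) (i≢j ∘ digit-injective)
  ... | c , ic≢jc = total-mono-< (λ c → ∸-monoʳ-≤ w (s≤s (i≤j c))) c
    (∸-monoʳ-< (s≤s (≤∧≢⇒< (i≤j c) ic≢jc)) (toℕ<n (digits j c)))

  defect-bounded : ∀ i → defect i ≤ suc r * w
  defect-bounded i = total-bounded {P = suc r} λ c → m∸n≤m w (suc (digit i c))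

  higher-strip : ∀ {s s′} → s′ / T < s / T → ∀ i j → high s′ j (suc zero) < low s i (suc zero)
  higher-strip {s} {s′} strip< i j = begin-strict
    s′ / T * w + digit j zero    <⟨ +-monoʳ-< (s′ / T * w) (toℕ<n (digits j zero)) ⟩
    s′ / T * w + w               ≡⟨ +-comm _ w ⟩
    suc (s′ / T) * w             ≤⟨ *-monoˡ-≤ w strip< ⟩
    s / T * w                    ≤⟨ m≤m+n _ _ ⟩
    s / T * w + digit i zero     ∎
    where open ≤-Reasoning

  -- The first hypothesis fits `K` strips side by side, the second fits `T` shifted antichains on
  -- top of each other.
  strips : ∀ {K} → K * w ≤ N → 2 * (suc r * w) + T < N → Sweeps (2 + r) (suc N) (w ^ suc r) (K * T)
  strips {K} wide tall = record
    { lo = low ; hi = high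
    ; lo≤hi = λ { s i zero → n≤1+n _ ; s i (suc c) → ≤-refl }
    ; lo<hi = λ s i → zero , ≤-refl
    ; hi-bound = bound ; separated = separate ; growing = grow }
    where
    open ≤-Reasoning
    bound : ∀ {s} → s < K * T → ∀ i c → suc (high s i c) < suc N
    bound {s} s<KT i zero = s≤s (begin-strict
      suc (2 * defect i + s % T)   ≡⟨ +-suc (2 * defect i) _ ⟨
      2 * defect i + suc (s % T)   ≤⟨ +-mono-≤ (*-monoʳ-≤ 2 (defect-bounded i)) (m%n<n s T) ⟩
      2 * (suc r * w) + T          <⟨ tall ⟩
      N                            ∎)
    bound {s} s<KT i (suc c) = s≤s (begin-strict
      s / T * w + digit i c        <⟨ +-monoʳ-< (s / T * w) (toℕ<n (digits i c)) ⟩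
      s / T * w + w                ≡⟨ +-comm _ w ⟩
      suc (s / T) * w              ≤⟨ *-monoˡ-≤ w (m<n*o⇒m/o<n {n = K} s<KT) ⟩
      K * w                        ≤⟨ wide ⟩
      N                            ∎)
    separate : ∀ {s s′ i j} → s′ ≤ s → i ≢ j → ∃ λ c → high s′ j c < low s i c
    separate {s} {s′} {i} {j} s′≤s i≢j with m≤n⇒m<n∨m≡n (/-monoˡ-≤ T s′≤s)
    ... | inj₁ strip< = suc zero , higher-strip strip< i j
    ... | inj₂ strip≡ with Fin.all? (λ c → digit i c ≤? digit j c)
    ... | no i≰j = let c , ic≰jc = Fin.¬∀⟶∃¬ _ _ (λ c → digit i c ≤? digit j c) i≰j in
      suc c , subst (λ t → t * w + digit j c < s / T * w + digit i c) (sym strip≡) (+-monoʳ-< (s / T * w) (≰⇒> ic≰jc))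
    -- All digits of `i` are at most those of `j`, so `i` has the larger defect; the resulting gain
    -- of 2 beats the `suc` in `high`.
    ... | yes i≤j = zero , (begin-strict
      suc (2 * defect j + s′ % T)      ≡⟨ +-suc (2 * defect j) _ ⟨
      2 * defect j + suc (s′ % T)      <⟨ +-monoʳ-< (2 * defect j) (s≤s (s≤s offset≤)) ⟩
      2 * defect j + (2 + s % T)       ≡⟨ +-assoc (2 * defect j) 2 _ ⟨
      2 * defect j + 2 + s % T         ≡⟨ cong (_+ s % T) (+-comm (2 * defect j) 2) ⟩
      2 + 2 * defect j + s % T         ≡⟨ cong (_+ s % T) (*-suc 2 (defect j)) ⟨
      2 * suc (defect j) + s % T       ≤⟨ +-monoˡ-≤ (s % T) (*-monoʳ-≤ 2 (defect-< i≢j i≤j)) ⟩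
      2 * defect i + s % T             ∎)
      where
      offset≤ : s′ % T ≤ s % T
      offset≤ = +-cancelʳ-≤ (s / T * T) _ _ (subst₂ _≤_ (trans (m≡m%n+[m/n]*n s′ T) (cong (λ t → s′ % T + t * T) strip≡)) (m≡m%n+[m/n]*n s T) s′≤s)
    grow : ∀ {s s′} → s′ < s → ∀ i → ∃ λ c → high s′ i c < high s i c
    grow {s} {s′} s′<s i with m≤n⇒m<n∨m≡n (/-monoˡ-≤ T (<⇒≤ s′<s))
    ... | inj₁ strip< = suc zero , higher-strip strip< i i
    ... | inj₂ strip≡ = zero , s≤s (+-monoʳ-< (2 * defect i) (+-cancelʳ-< (s / T * T) _ _
      (subst₂ _<_ (trans (m≡m%n+[m/n]*n s′ T) (cong (λ t → s′ % T + t * T) strip≡)) (m≡m%n+[m/n]*n s T) s′<s)))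

-- There are `K * T` sweeps, each with as many charged uses as columns beyond the reserve. Truncated
-- subtraction makes the degenerate cases trivial.
lower-bound : ∀ r {w K T L N k} → K * w ≤ N → 2 * (suc r * w) + T < N →
  BuilderWinsWithin (2 + r) (suc N) k → L * (K * T * (w ^ suc r ∸ 2 * (2 + r) ^ L)) ≤ k
lower-bound r {w} {K} {zero} {L} {k = k} wide tall F = ≤-trans (≤-reflexive vanish) z≤n
  where
  vanish : L * (K * 0 * (w ^ suc r ∸ 2 * (2 + r) ^ L)) ≡ 0
  vanish = trans (cong (λ x → L * (x * (w ^ suc r ∸ 2 * (2 + r) ^ L))) (*-zeroʳ K)) (*-zeroʳ L)
lower-bound r {w} {K} {T@(suc _)} {L} {N} {k} wide tall F with K * T in KT | w ^ suc r ∸ 2 * (2 + r) ^ L in wD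
... | zero  | _     = subst (_≤ k) (sym (*-zeroʳ L)) z≤n
... | suc ρ | zero  = subst (_≤ k) (sym (trans (cong (L *_) (*-zeroʳ ρ)) (*-zeroʳ L))) z≤n
... | suc ρ | suc D = painter-survives F
  where
  width : w ^ suc r ≡ 2 * (2 + r) ^ L + suc D
  width = trans (sym (m+[n∸m]≡n {2 * (2 + r) ^ L} (<⇒≤ (m∸n≢0⇒n<m λ eq → contradiction (trans (sym wD) eq) λ ()))))
    (cong (2 * (2 + r) ^ L +_) wD)
  open Painter {L = L} {D} {ρ} (s≤s (s≤s z≤n)) (s≤s (m<n⇒0<n tall))
    (subst₂ (Sweeps (2 + r) (suc N)) width KT (Strips.strips r w T N {K} wide tall))

-- Asymptotics

-- An integer logarithm: `p` is the floor of the base `b` logarithm of `x / B`.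
geometric-bracket : ∀ b B x → 1 < b → 0 < B → B ≤ x → ∃ λ p → B * b ^ p ≤ x × x < B * b ^ suc p
geometric-bracket b B zero 1<b 0<B B≤0 = contradiction B≤0 (<⇒≱ 0<B)
geometric-bracket b B (suc x) 1<b 0<B B≤1+x with m≤n⇒m<n∨m≡n B≤1+x
... | inj₂ refl = 0 , ≤-reflexive (*-identityʳ B) , subst (B <_) (cong (B *_) (sym (*-identityʳ b))) (m<m*n B b 1<b)
... | inj₁ B<1+x with geometric-bracket b B x 1<b 0<B (≤-pred B<1+x)
... | p , lo , hi with m≤n⇒m<n∨m≡n hi
... | inj₁ 1+x<hi = p , m≤n⇒m≤1+n lo , 1+x<hi
... | inj₂ 1+x≡hi = suc p , ≤-reflexive (sym 1+x≡hi) ,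
  subst (_< B * b ^ (2 + p)) (sym 1+x≡hi) (*-monoʳ-< B ⦃ >-nonZero 0<B ⦄ (^-monoʳ-< b 1<b (n<1+n (suc p))))

n<2^n : ∀ n → n < 2 ^ n
n<2^n zero    = s≤s z≤n
n<2^n (suc n) = subst (suc (suc n) ≤_) (cong (2 ^ n +_) (sym (+-identityʳ (2 ^ n))))
  (+-mono-≤ (m^n>0 2 n) (n<2^n n))

-- This and the next lemma let an integer `p` below or above log₂ `n` stand for the logarithm.
2^-≤-^ : ∀ {n p e} X → 2 ^ p ≤ n → e ≤ p * X → 2 ^ e ≤ n ^ X
2^-≤-^ {n} {p} {e} X 2^p≤n e≤pX = begin
  2 ^ e         ≤⟨ ^-monoʳ-≤ 2 e≤pX ⟩
  2 ^ (p * X)   ≡⟨ ^-*-assoc 2 p X ⟨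
  (2 ^ p) ^ X   ≤⟨ ^-monoˡ-≤ X 2^p≤n ⟩
  n ^ X         ∎
  where open ≤-Reasoning

^-≤-2^ : ∀ {n p e} X → n ≤ 2 ^ p → p * X ≤ e → n ^ X ≤ 2 ^ e
^-≤-2^ {n} {p} {e} X n≤2^p pX≤e = begin
  n ^ X         ≤⟨ ^-monoˡ-≤ X n≤2^p ⟩
  (2 ^ p) ^ X   ≡⟨ ^-*-assoc 2 p X ⟩
  2 ^ (p * X)   ≤⟨ ^-monoʳ-≤ 2 pX≤e ⟩
  2 ^ e         ∎
  where open ≤-Reasoning

2^-cancel-< : ∀ {a b} → 2 ^ a < 2 ^ b → a < b
2^-cancel-< 2^a<2^b = ≰⇒> λ b≤a → <⇒≱ 2^a<2^b (^-monoʳ-≤ 2 b≤a)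

^-distribʳ-* : ∀ a b e → (a * b) ^ e ≡ a ^ e * b ^ e
^-distribʳ-* a b zero    = refl
^-distribʳ-* a b (suc e) = trans (cong (a * b *_) (^-distribʳ-* a b e)) (swap a b (a ^ e) (b ^ e))
  where
  swap : ∀ a b x y → a * b * (x * y) ≡ a * x * (b * y)
  swap = solve-∀

-- Bernoulli's inequality for `(1 + 1/r) ^ j` with denominators cleared.
bernoulli : ∀ r j → r ^ j * (r + j) ≤ r * suc r ^ j
bernoulli r zero = ≤-reflexive (base r)
  where
  base : ∀ r → 1 * (r + 0) ≡ r * 1
  base = solve-∀
bernoulli r (suc j) = begin
  r * r ^ j * (r + suc j)                 ≤⟨ m≤m+n _ (r ^ j * j) ⟩
  r * r ^ j * (r + suc j) + r ^ j * j     ≡⟨ factor r (r ^ j) j ⟩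
  suc r * (r ^ j * (r + j))               ≤⟨ *-monoʳ-≤ (suc r) (bernoulli r j) ⟩
  suc r * (r * suc r ^ j)                 ≡⟨ swap (suc r) r (suc r ^ j) ⟩
  r * (suc r * suc r ^ j)                 ∎
  where
  open ≤-Reasoning
  factor : ∀ r x j → r * x * (r + suc j) + x * j ≡ suc r * (x * (r + j))
  factor = solve-∀
  swap : ∀ a b c → a * (b * c) ≡ b * (a * c)
  swap = solve-∀

-- Consequently `suc r` of builder's edges at least halve the list of remaining tops.
2*r^[1+r]≤[1+r]^[1+r] : ∀ r → 0 < r → 2 * r ^ suc r ≤ suc r ^ suc r
2*r^[1+r]≤[1+r]^[1+r] r 0<r = *-cancelˡ-≤ r ⦃ >-nonZero 0<r ⦄ (begin
  r * (2 * r ^ suc r)        ≡⟨ shuffle r (r ^ suc r) ⟩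
  r ^ suc r * (r + r)        ≤⟨ *-monoʳ-≤ (r ^ suc r) (+-monoʳ-≤ r (n≤1+n r)) ⟩
  r ^ suc r * (r + suc r)    ≤⟨ bernoulli r (suc r) ⟩
  r * suc r ^ suc r          ∎)
  where
  open ≤-Reasoning
  shuffle : ∀ r x → r * (2 * x) ≡ x * (r + r)
  shuffle = solve-∀

-- Upper bounds from builder's strategy

suc[N^r*N]≤ : ∀ N r → suc (N ^ r * N) ≤ suc N ^ suc r
suc[N^r*N]≤ N r = begin
  suc (N ^ r * N)                   ≡⟨ +-comm 1 _ ⟩
  N ^ r * N + 1                     ≤⟨ +-mono-≤ (*-monoˡ-≤ N (^-monoˡ-≤ r (n≤1+n N))) (m^n>0 (suc N) r) ⟩
  suc N ^ r * N + suc N ^ r         ≡⟨ +-comm _ (suc N ^ r) ⟩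
  suc N ^ r + suc N ^ r * N         ≡⟨ cong (suc N ^ r +_) (*-comm (suc N ^ r) N) ⟩
  suc N ^ suc r                     ∎
  where open ≤-Reasoning

-- A round costs `suc p` edges, where `p` is the floor of log₂ `n`. Since `suc m ≤ p`, the surplus 1
-- is absorbed by the factor `(m + 2) / (m + 1)`.
two-colour-upper : ∀ m n → 2 ^ suc m ≤ n →
  ∃ λ k → BuilderWinsWithin 2 n k × 2 ^ (k * suc m) ≤ n ^ (suc (suc m) * (n * n))
two-colour-upper m zero big = contradiction big (<⇒≱ (m^n>0 2 (suc m)))
two-colour-upper m n@(suc N) big with geometric-bracket 2 1 n ≤-refl ≤-refl (s≤s z≤n)
... | p , lo , hi = _ , Builder.builder-wins 1 N 0<N (suc p) enough ,
  2^-≤-^ {p = p} (suc (suc m) * (n * n)) (subst (_≤ n) (*-identityˡ _) lo) (begin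
    suc (N ^ 1 * N) * suc p * suc m    ≤⟨ *-monoˡ-≤ (suc m) (*-monoˡ-≤ (suc p) (suc[N^r*N]≤ N 1)) ⟩
    n * (n * 1) * suc p * suc m        ≡⟨ regroup n p m ⟩
    (p * suc m + suc m) * (n * n)      ≤⟨ *-monoˡ-≤ (n * n) (+-monoʳ-≤ (p * suc m) 1+m≤p) ⟩
    (p * suc m + p) * (n * n)          ≡⟨ regroup′ n p m ⟩
    p * (suc (suc m) * (n * n))        ∎)
  where
  open ≤-Reasoning
  1+m≤p : suc m ≤ p
  1+m≤p = ≤-pred (2^-cancel-< (≤-<-trans big (subst (n <_) (*-identityˡ _) hi)))
  0<N : 0 < N
  0<N = ≤-pred (≤-trans (^-monoʳ-≤ 2 (s≤s (z≤n {m}))) big)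
  enough : N ^ 1 * 1 ^ suc p < 2 ^ suc p
  enough = begin-strict
    N ^ 1 * 1 ^ suc p   ≡⟨ cong₂ _*_ (^-identityʳ N) (^-zeroˡ (suc p)) ⟩
    N * 1               ≡⟨ *-identityʳ N ⟩
    N                   <⟨ n<1+n N ⟩
    n                   <⟨ hi ⟩
    1 * 2 ^ suc p       ≡⟨ *-identityˡ _ ⟩
    2 ^ suc p           ∎
  regroup : ∀ n p m → n * (n * 1) * suc p * suc m ≡ (p * suc m + suc m) * (n * n)
  regroup = solve-∀
  regroup′ : ∀ n p m → (p * suc m + p) * (n * n) ≡ p * (suc (suc m) * (n * n))
  regroup′ = solve-∀

many-colours-upper : ∀ r n → 2 ≤ n → let q = 2 + r in
  ∃ λ k → BuilderWinsWithin q n k × 2 ^ (k * 1) ≤ n ^ (q * suc r * 2 * n ^ q)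
many-colours-upper r₀ n@(suc N) (s≤s 0<N) with geometric-bracket 2 1 (suc N) ≤-refl ≤-refl (s≤s z≤n)
... | p , lo , hi = _ , Builder.builder-wins r N 0<N J enough ,
  2^-≤-^ {p = p} (q * r * 2 * n ^ q) (subst (_≤ n) (*-identityˡ _) lo) (begin
    suc (N ^ r * N) * J * 1       ≡⟨ *-identityʳ _ ⟩
    suc (N ^ r * N) * J           ≤⟨ *-monoˡ-≤ J (suc[N^r*N]≤ N r) ⟩
    n ^ q * J                     ≤⟨ *-monoʳ-≤ (n ^ q) (*-monoʳ-≤ q (*-monoʳ-≤ r (+-monoˡ-≤ p 0<p))) ⟩
    n ^ q * (q * (r * (p + p)))   ≡⟨ regroup (n ^ q) q r p ⟩
    p * (q * r * 2 * n ^ q)       ∎)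
  where
  open ≤-Reasoning
  r = suc r₀
  q = suc r
  -- `e` halvings, of `q` edges each, bring the `N ^ r` columns below 1 because `N < 2 ^ suc p`.
  e = r * suc p
  J = q * e
  n<2^1+p : n < 2 ^ suc p
  n<2^1+p = subst (n <_) (*-identityˡ _) hi
  0<p : 0 < p
  0<p = ≤-pred (2^-cancel-< {1} (≤-<-trans (s≤s 0<N) n<2^1+p))
  regroup : ∀ x q r p → x * (q * (r * (p + p))) ≡ p * (q * r * 2 * x)
  regroup = solve-∀
  enough : N ^ r * r ^ J < q ^ J
  enough = begin-strict
    N ^ r * r ^ J                   <⟨ *-monoˡ-< (r ^ J) ⦃ m^n≢0 r J ⦄ (^-monoˡ-< r (<-trans (n<1+n N) n<2^1+p)) ⟩
    (2 ^ suc p) ^ r * r ^ J         ≡⟨ cong (_* r ^ J) (trans (^-*-assoc 2 (suc p) r) (cong (2 ^_) (*-comm (suc p) r))) ⟩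
    2 ^ e * r ^ J                   ≡⟨ cong (2 ^ e *_) (^-*-assoc r q e) ⟨
    2 ^ e * (r ^ q) ^ e             ≡⟨ ^-distribʳ-* 2 (r ^ q) e ⟨
    (2 * r ^ q) ^ e                 ≤⟨ ^-monoˡ-≤ e (2*r^[1+r]≤[1+r]^[1+r] r (s≤s z≤n)) ⟩
    (q ^ q) ^ e                     ≡⟨ ^-*-assoc q q e ⟩
    q ^ J                           ∎

-- Lower bounds from painter's strategy

0-edges-insufficient : ∀ {q n cur} → ¬ Forces q (2 + n) 0 cur []
0-edges-insufficient (win (_ , _ , extend _ ()))
0-edges-insufficient (next F) = 0-edges-insufficient F

-- For large `n` one strip with `T = w` of order `n` suffices. The constant collects `3 + 3 * q`
-- from log₂ `n` against `L`, `(2 * q * q) ^ q` from `n` against `w`, and 2 from the reserve;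
-- `b * b ^ q` covers `n ≤ b`.
many-colours-lower : ∀ r → let q = 2 + r ; b = 8 * q * q in
  ∀ n → 2 ≤ n → ∀ k → BuilderWinsWithin q n k →
  n ^ (1 * n ^ q) ≤ 2 ^ (k * ((3 + 3 * q) * (2 * q * q) ^ q * 2 + b * b ^ q))
many-colours-lower r₀ n@(suc N) (s≤s 0<N) zero F = contradiction F (no-edges 0<N)
  where
  no-edges : ∀ {q N} → 0 < N → ¬ BuilderWinsWithin q (suc N) 0
  no-edges (s≤s _) = 0-edges-insufficient
many-colours-lower r₀ n@(suc N) (s≤s 0<N) k@(suc k₀) F with 8 * (2 + r₀) * (2 + r₀) ≤? N
... | no b≰N = ^-≤-2^ {p = n} (1 * n ^ q) (<⇒≤ (n<2^n n)) (begin
    n * (1 * n ^ q)           ≡⟨ cong (n *_) (*-identityˡ (n ^ q)) ⟩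
    n * n ^ q                 ≤⟨ *-mono-≤ n≤b (^-monoˡ-≤ q n≤b) ⟩
    b * b ^ q                 ≤⟨ m≤n+m (b * b ^ q) d ⟩
    d + b * b ^ q             ≤⟨ m≤m+n _ _ ⟩
    k * (d + b * b ^ q)       ∎)
  where
  open ≤-Reasoning
  q = 2 + r₀
  b = 8 * q * q
  d = (3 + 3 * q) * (2 * q * q) ^ q * 2
  n≤b : n ≤ b
  n≤b = ≰⇒> b≰N
... | yes b≤N with geometric-bracket (2 + r₀) (8 * (2 + r₀) * (2 + r₀)) N (s≤s (s≤s z≤n)) (s≤s z≤n) b≤N
... | l , lo , hi = ^-≤-2^ {p = (3 + 3 * q) * L} (1 * n ^ q) n≤2^ (begin
    (3 + 3 * q) * L * (1 * n ^ q)                          ≤⟨ *-monoʳ-≤ ((3 + 3 * q) * L) (*-monoʳ-≤ 1 (^-monoˡ-≤ q n≤)) ⟩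
    (3 + 3 * q) * L * (1 * (2 * q * q * w) ^ q)            ≡⟨ cong (λ x → (3 + 3 * q) * L * (1 * x)) (^-distribʳ-* (2 * q * q) w q) ⟩
    (3 + 3 * q) * L * (1 * ((2 * q * q) ^ q * w ^ q))      ≡⟨ regroup (3 + 3 * q) L ((2 * q * q) ^ q) (w ^ q) ⟩
    (3 + 3 * q) * (2 * q * q) ^ q * (L * w ^ q)            ≤⟨ *-monoʳ-≤ ((3 + 3 * q) * (2 * q * q) ^ q) half-bound ⟩
    (3 + 3 * q) * (2 * q * q) ^ q * (k * 2)                ≡⟨ regroup′ ((3 + 3 * q) * (2 * q * q) ^ q) k ⟩
    k * d                                                  ≤⟨ *-monoʳ-≤ k (m≤m+n d _) ⟩
    k * (d + b * b ^ q)                                    ∎)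
  where
  open ≤-Reasoning
  r = suc r₀
  q = 2 + r₀
  b = 8 * q * q
  d = (3 + 3 * q) * (2 * q * q) ^ q * 2
  L = suc l
  -- The reserve `2 * q ^ L` is then half of `w`, hence at most half of the `w ^ r` columns, while
  -- `2 * q * w` equals `b * q ^ l` and so fits into `N`.
  w = 4 * q ^ L
  regroup : ∀ c L x y → c * L * (1 * (x * y)) ≡ c * x * (L * y)
  regroup = solve-∀
  regroup′ : ∀ c k → c * (k * 2) ≡ k * (c * 2)
  regroup′ = solve-∀
  0<w : 0 < w
  0<w = ≤-trans (m^n>0 q L) (m≤m+n (q ^ L) _)
  2qw≤N : 2 * q * w ≤ N
  2qw≤N = ≤-trans (≤-reflexive (shape q (q ^ l))) lo
    where
    shape : ∀ q x → 2 * q * (4 * (q * x)) ≡ 8 * q * q * x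
    shape = solve-∀
  wide : 1 * w ≤ N
  wide = ≤-trans (*-monoˡ-≤ w {1} {2 * q} (s≤s z≤n)) 2qw≤N
  tall : 2 * (r * w) + w < N
  tall = begin-strict
    2 * (r * w) + w        <⟨ +-monoʳ-< (2 * (r * w)) (m<m*n w 2 ⦃ >-nonZero 0<w ⦄ ≤-refl) ⟩
    2 * (r * w) + w * 2    ≡⟨ shape r w ⟩
    2 * q * w              ≤⟨ 2qw≤N ⟩
    N                      ∎
    where
    shape : ∀ r w → 2 * (r * w) + w * 2 ≡ 2 * (1 + r) * w
    shape = solve-∀
  half : w ^ r ≤ (w ^ r ∸ 2 * q ^ L) * 2
  half = +-cancelʳ-≤ w _ _ (begin
    w ^ r + w                                   ≤⟨ +-monoʳ-≤ (w ^ r) w≤w^r ⟩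
    w ^ r + w ^ r                               ≤⟨ +-mono-≤ split split ⟩
    (2 * q ^ L + x) + (2 * q ^ L + x)           ≡⟨ shape (q ^ L) x ⟩
    x * 2 + w                                   ∎)
    where
    x = w ^ r ∸ 2 * q ^ L
    split : w ^ r ≤ 2 * q ^ L + x
    split = m≤n+m∸n (w ^ r) (2 * q ^ L)
    w≤w^r : w ≤ w ^ r
    w≤w^r = m≤m*n w (w ^ r₀) ⦃ m^n≢0 w r₀ ⦃ >-nonZero 0<w ⦄ ⦄
    shape : ∀ y x → (2 * y + x) + (2 * y + x) ≡ x * 2 + 4 * y
    shape = solve-∀
  half-bound : L * w ^ q ≤ k * 2
  half-bound = begin
    L * (w * w ^ r)                                   ≤⟨ *-monoʳ-≤ L (*-monoʳ-≤ w half) ⟩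
    L * (w * ((w ^ r ∸ 2 * q ^ L) * 2))               ≡⟨ shape L w (w ^ r ∸ 2 * q ^ L) ⟩
    L * (1 * w * (w ^ r ∸ 2 * q ^ L)) * 2             ≤⟨ *-monoˡ-≤ 2 (lower-bound r₀ {K = 1} {w} {L} wide tall F) ⟩
    k * 2                                             ∎
    where
    shape : ∀ L w x → L * (w * (x * 2)) ≡ L * (1 * w * x) * 2
    shape = solve-∀
  n≤ : n ≤ 2 * q * q * w
  n≤ = ≤-trans hi (≤-reflexive (shape q (q ^ l)))
    where
    shape : ∀ q x → 8 * q * q * (q * x) ≡ 2 * q * q * (4 * (q * x))
    shape = solve-∀
  n≤2^ : n ≤ 2 ^ ((3 + 3 * q) * L)
  n≤2^ = begin
    n                              ≤⟨ hi ⟩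
    8 * q * q * q ^ L              ≡⟨ shape q (q ^ L) ⟩
    8 * q ^ (2 + L)                ≤⟨ *-monoʳ-≤ 8 (^-monoˡ-≤ (2 + L) (<⇒≤ (n<2^n q))) ⟩
    8 * (2 ^ q) ^ (2 + L)          ≡⟨ cong (8 *_) (^-*-assoc 2 q (2 + L)) ⟩
    2 ^ 3 * 2 ^ (q * (2 + L))      ≡⟨ ^-distribˡ-+-* 2 3 (q * (2 + L)) ⟨
    2 ^ (3 + q * (2 + L))          ≤⟨ ^-monoʳ-≤ 2 (≤-trans (m≤m+n (3 + q * (2 + L)) ((3 + 2 * q) * l)) (≤-reflexive (shape′ q l))) ⟩
    2 ^ ((3 + 3 * q) * L)          ∎
    where
    shape : ∀ q x → 8 * q * q * x ≡ 8 * (q * (q * x))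
    shape = solve-∀
    shape′ : ∀ q l → 3 + q * (2 + suc l) + (3 + 2 * q) * l ≡ (3 + 3 * q) * suc l
    shape′ = solve-∀

-- Relative losses are about `1 / K` in the edges `L`, `4 / K` in the heights `T`, and twice `1 / K`
-- in the widths. Together they are at most `7 / K`, less than `1 / (m + 1)` for `K = 10 * suc m`.
two-colour-lower : ∀ m → ∃ λ n₀ → ∀ n → n₀ ≤ n → ∀ k → BuilderWinsWithin 2 n k → n ^ (m * (n * n)) ≤ 2 ^ (k * suc m)
two-colour-lower m = 2 ^ (K * suc d) , bound
  where
  open ≤-Reasoning
  K K₁ K₄ d : ℕ
  K = 10 * suc m
  K₁ = 9 + 10 * m
  K₄ = 6 + 10 * m
  -- As `d < 2 ^ d`, taking `L = p ∸ d` makes the reserve `2 * 2 ^ L` at most `w / K`. The bound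
  -- `K * suc d ≤ p`, from the choice of `n₀`, keeps `L` close to `p`.
  d = 4 * (K * K)
  K≡1+K₁ : K ≡ suc K₁
  K≡1+K₁ = *-suc 10 m
  K≡4+K₄ : K ≡ 4 + K₄
  K≡4+K₄ = *-suc 10 m
  affordable : m * (K * K * K * K * K) ≤ suc m * (K₁ * (K₄ * (K₁ * K₁ * K)))
  affordable = ≤-trans (m≤m+n _ _) (≤-reflexive (expand m))
    where
    -- The difference of the two sides is a polynomial in `m` with nonnegative coefficients.
    expand : ∀ m → m * (10 * suc m * (10 * suc m) * (10 * suc m) * (10 * suc m) * (10 * suc m))
      + 10 * suc m * (suc m * (3000 * m * m * m + 10500 * m * m + 11870 * m + 4374))
      ≡ suc m * ((9 + 10 * m) * ((6 + 10 * m) * ((9 + 10 * m) * (9 + 10 * m) * (10 * suc m))))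
    expand = solve-∀
  bound : ∀ n → 2 ^ (K * suc d) ≤ n → ∀ k → BuilderWinsWithin 2 n k → n ^ (m * (n * n)) ≤ 2 ^ (k * suc m)
  bound zero big = contradiction big (<⇒≱ (m^n>0 2 (K * suc d)))
  bound n@(suc N) big k F with geometric-bracket 2 1 n ≤-refl ≤-refl (s≤s z≤n)
  ... | p , lo , hi = ^-≤-2^ {p = suc p} (m * (n * n)) (<⇒≤ n<2^1+p)
    (*-cancelˡ-≤ (K * K * K * K * K) (begin
      K * K * K * K * K * (suc p * (m * (n * n)))                  ≡⟨ regroup (K * K * K * K * K) p m n ⟩
      m * (K * K * K * K * K) * (suc p * (n * n))                  ≤⟨ *-monoˡ-≤ (suc p * (n * n)) affordable ⟩
      suc m * (K₁ * (K₄ * (K₁ * K₁ * K))) * (suc p * (n * n))      ≡⟨ distribute m K K₁ K₄ p n ⟩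
      suc m * K * ((K₁ * suc p) * ((K₄ * n) * (K₁ * (K₁ * n))))    ≤⟨ *-monoʳ-≤ (suc m * K) (*-mono-≤ edges (*-mono-≤ heights widths)) ⟩
      suc m * K * ((K * L) * ((K * T) * (K * (K * (K * X)))))      ≡⟨ collect m K L T X ⟩
      K * K * K * K * K * (L * (K * T * X) * suc m)                ≤⟨ *-monoʳ-≤ (K * K * K * K * K) (*-monoˡ-≤ (suc m) (lower-bound 0 {w} {K} {T} {L} wide tall F)) ⟩
      K * K * K * K * K * (k * suc m)                              ∎))
    where
    n<2^1+p : n < 2 ^ suc p
    n<2^1+p = subst (n <_) (*-identityˡ _) hi
    2^p≤n : 2 ^ p ≤ n
    2^p≤n = subst (_≤ n) (*-identityˡ _) lo
    K[1+d]≤p : K * suc d ≤ p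
    K[1+d]≤p = ≤-pred (2^-cancel-< (≤-<-trans big n<2^1+p))
    d≤p : d ≤ p
    d≤p = ≤-trans (≤-trans (n≤1+n d) (m≤n*m (suc d) K)) K[1+d]≤p
    L w T X : ℕ
    L = p ∸ d
    w = N / K
    -- The largest value allowed by `tall`.
    T = N ∸ suc (2 * (1 * w))
    X = w ^ 1 ∸ 2 * 2 ^ L
    4KK≤2^d : 4 * (K * K) ≤ 2 ^ d
    4KK≤2^d = <⇒≤ (n<2^n d)
    KK≤n : K * K ≤ n
    KK≤n = begin
      K * K              ≤⟨ m≤n*m (K * K) 4 ⟩
      d                  ≤⟨ 4KK≤2^d ⟩
      2 ^ d              ≤⟨ ^-monoʳ-≤ 2 d≤p ⟩
      2 ^ p              ≤⟨ 2^p≤n ⟩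
      n                  ∎
    K≤N : K ≤ N
    K≤N = ≤-pred (≤-trans (m<m*n K K 1<K) KK≤n)
      where
      1<K : 1 < K
      1<K = subst (1 <_) (sym K≡1+K₁) (s≤s (s≤s z≤n))
    0<w : 0 < w
    0<w = m≥n⇒m/n>0 K≤N
    wide : K * w ≤ N
    wide = subst (_≤ N) (*-comm w K) (m/n*n≤m N K)
    n≤Kw+K : n ≤ K * w + K
    n≤Kw+K = begin
      suc N                      ≡⟨ cong suc (m≡m%n+[m/n]*n N K) ⟩
      suc (N % K) + w * K        ≤⟨ +-monoˡ-≤ (w * K) (m%n<n N K) ⟩
      K + w * K                  ≡⟨ +-comm K (w * K) ⟩
      w * K + K                  ≡⟨ cong (_+ K) (*-comm w K) ⟩
      K * w + K                  ∎
    room : suc (2 * (1 * w)) ≤ N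
    room = begin
      suc (2 * (1 * w))      ≤⟨ +-monoˡ-≤ _ 0<w ⟩
      w + 2 * (1 * w)        ≡⟨ shape w ⟩
      3 * w                  ≤⟨ *-monoˡ-≤ w (≤-trans (m≤m+n 3 7) (*-monoʳ-≤ 10 (s≤s (z≤n {m})))) ⟩
      K * w                  ≤⟨ wide ⟩
      N                      ∎
      where
      shape : ∀ w → w + 2 * (1 * w) ≡ 3 * w
      shape = solve-∀
    tall : 2 * (1 * w) + T < N
    tall = ≤-reflexive (m+[n∸m]≡n room)
    edges : K₁ * suc p ≤ K * L
    edges = +-cancelʳ-≤ (suc p) _ _ (begin
      K₁ * suc p + suc p        ≡⟨ +-comm _ (suc p) ⟩
      suc K₁ * suc p            ≡⟨ cong (_* suc p) K≡1+K₁ ⟨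
      K * suc p                 ≡⟨ cong (λ p → K * suc p) (m+[n∸m]≡n d≤p) ⟨
      K * suc (d + L)           ≡⟨ *-distribˡ-+ K (suc d) L ⟩
      K * suc d + K * L         ≤⟨ +-monoˡ-≤ (K * L) (m≤n⇒m≤1+n K[1+d]≤p) ⟩
      suc p + K * L             ≡⟨ +-comm (suc p) _ ⟩
      K * L + suc p             ∎)
    heights : K₄ * n ≤ K * T
    heights = +-cancelˡ-≤ (4 * n) _ _ (begin
      4 * n + K₄ * n                            ≡⟨ *-distribʳ-+ n 4 K₄ ⟨
      (4 + K₄) * n                              ≡⟨ cong (_* n) K≡4+K₄ ⟨
      K * n                                     ≤⟨ *-monoʳ-≤ K (s≤s (m≤n+m∸n N (suc (2 * (1 * w))))) ⟩
      K * (2 + 2 * (1 * w) + T)                 ≡⟨ shape K w T ⟩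
      K + K + (K * w + K * w) + K * T           ≤⟨ +-monoˡ-≤ (K * T) (+-mono-≤ (+-mono-≤ K≤n K≤n) (+-mono-≤ Kw≤n Kw≤n)) ⟩
      n + n + (n + n) + K * T                   ≡⟨ cong (_+ K * T) (shape′ n) ⟩
      4 * n + K * T                             ∎)
      where
      K≤n : K ≤ n
      K≤n = m≤n⇒m≤1+n K≤N
      Kw≤n : K * w ≤ n
      Kw≤n = m≤n⇒m≤1+n wide
      shape : ∀ K w T → K * (2 + 2 * (1 * w) + T) ≡ K + K + (K * w + K * w) + K * T
      shape = solve-∀
      shape′ : ∀ n → n + n + (n + n) ≡ 4 * n
      shape′ = solve-∀
    K₁n≤KKw : K₁ * n ≤ K * (K * w)
    K₁n≤KKw = +-cancelˡ-≤ n _ _ (begin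
      n + K₁ * n               ≡⟨ cong (_* n) K≡1+K₁ ⟨
      K * n                    ≤⟨ *-monoʳ-≤ K n≤Kw+K ⟩
      K * (K * w + K)          ≡⟨ *-distribˡ-+ K (K * w) K ⟩
      K * (K * w) + K * K      ≤⟨ +-monoʳ-≤ (K * (K * w)) KK≤n ⟩
      K * (K * w) + n          ≡⟨ +-comm _ n ⟩
      n + K * (K * w)          ∎)
    threshold : K * (2 * 2 ^ L) ≤ w
    threshold = *-cancelˡ-≤ (2 * K) ⦃ m*n≢0 2 K ⦄ (begin
      2 * K * (K * (2 * 2 ^ L))     ≡⟨ shape K (2 ^ L) ⟩
      d * 2 ^ L                     ≤⟨ *-monoˡ-≤ (2 ^ L) 4KK≤2^d ⟩
      2 ^ d * 2 ^ L                 ≡⟨ ^-distribˡ-+-* 2 d L ⟨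
      2 ^ (d + L)                   ≡⟨ cong (2 ^_) (m+[n∸m]≡n d≤p) ⟩
      2 ^ p                         ≤⟨ 2^p≤n ⟩
      n                             ≤⟨ n≤Kw+K ⟩
      K * w + K                     ≤⟨ +-monoʳ-≤ (K * w) (m≤m*n K w ⦃ >-nonZero 0<w ⦄) ⟩
      K * w + K * w                 ≡⟨ shape′ K w ⟩
      2 * K * w                     ∎)
      where
      shape : ∀ K x → 2 * K * (K * (2 * x)) ≡ 4 * (K * K) * x
      shape = solve-∀
      shape′ : ∀ K w → K * w + K * w ≡ 2 * K * w
      shape′ = solve-∀
    K₁w≤KX : K₁ * w ≤ K * X
    K₁w≤KX = +-cancelˡ-≤ w _ _ (begin
      w + K₁ * w                       ≡⟨ cong (_* w) K≡1+K₁ ⟨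
      K * w                            ≡⟨ cong (K *_) (^-identityʳ w) ⟨
      K * w ^ 1                        ≤⟨ *-monoʳ-≤ K (m≤n+m∸n (w ^ 1) (2 * 2 ^ L)) ⟩
      K * (2 * 2 ^ L + X)              ≡⟨ *-distribˡ-+ K (2 * 2 ^ L) X ⟩
      K * (2 * 2 ^ L) + K * X          ≤⟨ +-monoˡ-≤ (K * X) threshold ⟩
      w + K * X                        ∎)
    widths : K₁ * (K₁ * n) ≤ K * (K * (K * X))
    widths = begin
      K₁ * (K₁ * n)           ≤⟨ *-monoʳ-≤ K₁ K₁n≤KKw ⟩
      K₁ * (K * (K * w))      ≡⟨ shape K₁ K w ⟩
      K * (K * (K₁ * w))      ≤⟨ *-monoʳ-≤ K (*-monoʳ-≤ K K₁w≤KX) ⟩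
      K * (K * (K * X))       ∎
      where
      shape : ∀ a K w → a * (K * (K * w)) ≡ K * (K * (a * w))
      shape = solve-∀
    regroup : ∀ c p m n → c * (suc p * (m * (n * n))) ≡ m * c * (suc p * (n * n))
    regroup = solve-∀
    distribute : ∀ m K a b p n → suc m * (a * (b * (a * a * K))) * (suc p * (n * n)) ≡ suc m * K * ((a * suc p) * ((b * n) * (a * (a * n))))
    distribute = solve-∀
    collect : ∀ m K L T X → suc m * K * ((K * L) * ((K * T) * (K * (K * (K * X))))) ≡ K * K * K * K * K * (L * (K * T * X) * suc m)
    collect = solve-∀

-- Exponentiation replaces real logarithms: the first inequality says that `k` is at least
-- `m / (m + 1)` times n² log₂ n, the second that it is at most `(m + 2) / (m + 1)` times it. As `m`
-- grows this is the factor 1 + o(1). In the second half `a / d` and `a' / d'` are the constants.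
theorem5 : ((m : ℕ) → ∃ λ N → (n : ℕ) → N ≤ n →
    ((k : ℕ) → BuilderWinsWithin 2 n k →
    n ^ (m * (n * n)) ≤ 2 ^ (k * suc m))
    × (∃ λ k → BuilderWinsWithin 2 n k ×
    2 ^ (k * suc m) ≤ n ^ (suc (suc m) * (n * n))))
    ×
    ((q : ℕ) → 2 ≤ q →
    ∃ λ a → ∃ λ d → ∃ λ a' → ∃ λ d' →
    1 ≤ a × 1 ≤ d × 1 ≤ a' × 1 ≤ d' ×
    ((n : ℕ) → 2 ≤ n →
    ((k : ℕ) → BuilderWinsWithin q n k →
    n ^ (a * n ^ q) ≤ 2 ^ (k * d))
    × (∃ λ k → BuilderWinsWithin q n k ×
    2 ^ (k * d') ≤ n ^ (a' * n ^ q))))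
theorem5 = two-colours , many-colours
  where
  two-colours : ∀ m → _
  two-colours m = let n₀ , lower = two-colour-lower m in n₀ ⊔ 2 ^ suc m , λ n large →
    lower n (≤-trans (m≤m⊔n n₀ _) large) , two-colour-upper m n (≤-trans (m≤n⊔m n₀ _) large)
  many-colours : ∀ q → 2 ≤ q → _
  many-colours (suc zero) (s≤s ())
  many-colours q@(suc (suc r)) _ =
    1 , d + b * b ^ q , q * suc r * 2 , 1 ,
    s≤s z≤n , ≤-trans (*-mono-≤ {1} {b} (s≤s z≤n) (m^n>0 b q)) (m≤n+m (b * b ^ q) d) , s≤s z≤n , s≤s z≤n ,
    λ n 2≤n → many-colours-lower r n 2≤n , many-colours-upper r n 2≤n
    where
    b = 8 * q * q
    d = (3 + 3 * q) * (2 * q * q) ^ q * 2
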